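{- The set $R^+_{ure}$ of all $e$ such that $\mathrm{RTD}^+(\mathcal L_e)$ is finite and witnessed by a uniformly r.e. positive teaching sequence for $\mathcal L_e$ is $\Sigma^0_5$ (i.e. definable by a $\Sigma^0_5$ formula).
   Context: $W_0,W_1,\ldots$ is an acceptable numbering of all r.e. subsets of $\mathbb N$; $L^e_j = \{x : \langle j,x\rangle \in W_e\}$ and $\mathcal L_e = \{L^e_j : j\in\mathbb N\}$. A positive teaching sequence for a family $\mathcal L$ is a sequence $((\mathcal F_0,d_0),(\mathcal F_1,d_1),\ldots)$ (indexed by an initial segment of $\mathbb N$) such that (i) the $\mathcal F_i$ are nonempty and form a partition of $\mathcal L$, and (ii) for every $i$ and every $L\in\mathcal F_i$ there is $S_L\subseteq L$ with $|S_L| = d_i<\infty$ such that for all $L'\in\bigcup_{j\geq i}\mathcal F_j$, $S_L\subseteq L'$ implies $L=L'$. Its order is $\sup_i d_i$, and $\mathrm{RTD}^+(\mathcal L)$ is the infimum of orders of positive teaching sequences for $\mathcal L$. The sequence is uniformly r.e. if there is an r.e. set $W$ with $\mathcal F_i = \{\{x : \langle i,j,x\rangle\in W\} : j\in\mathbb N\}$ for all $i$. "Finite and witnessed by" means there is such a uniformly r.e. positive teaching sequence of finite order. -}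

module Defs where

open import Data.Nat using (ℕ; zero; suc; _+_; _≤_; _<_)
open import Data.Nat.DivMod using (_mod_)
open import Data.Fin using (Fin)
open import Data.Vec using (Vec; []; _∷_; lookup)
open import Data.List using (List; length)
open import Data.List.Relation.Unary.All using (All)
open import Data.List.Relation.Unary.Unique.Propositional using (Unique)
open import Data.Product using (Σ; ∃; ∃-syntax; _×_; _,_; proj₁; proj₂)
open import Data.Unit using (⊤)
open import Relation.Binary.PropositionalEquality using (_≡_)
open import Function.Bundles using (_⇔_)

tri : ℕ → ℕ
tri zero    = zero
tri (suc k) = tri k + suc k

pair : ℕ → ℕ → ℕ
pair x y = tri (x + y) + y

unpair : ℕ → ℕ × ℕ
unpair zero = 0 , 0
unpair (suc n) with unpair n
... | zero  , y = suc y , 0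
... | suc x , y = x , suc y

triple : ℕ → ℕ → ℕ → ℕ
triple i j x = pair i (pair j x)

data PR : ℕ → Set where
  zer  : ∀ {n} → PR n
  succ : PR 1
  proj : ∀ {n} → Fin n → PR n
  comp : ∀ {m n} → PR m → Vec (PR n) m → PR n
  prec : ∀ {n} → PR n → PR (suc (suc n)) → PR (suc n)

mutual
  eval : ∀ {n} → PR n → Vec ℕ n → ℕ
  eval zer         v            = 0
  eval succ        (x ∷ [])     = suc x
  eval (proj i)    v            = lookup v i
  eval (comp g hs) v            = eval g (evalVec hs v)
  eval (prec g h)  (zero ∷ v)   = eval g v
  eval (prec g h)  (suc x ∷ v)  = eval h (x ∷ eval (prec g h) (x ∷ v) ∷ v)

  evalVec : ∀ {m n} → Vec (PR n) m → Vec ℕ n → Vec ℕ m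
  evalVec []       v = []
  evalVec (h ∷ hs) v = eval h v ∷ evalVec hs v

succOr : (n : ℕ) → PR n
succOr (suc zero) = succ
succOr _          = zer

projOr : (n : ℕ) → ℕ → PR n
projOr zero    r = zer
projOr (suc n) r = proj (r mod suc n)

mutual
  decode : ℕ → (n : ℕ) → ℕ → PR n
  decode zero    n c = zer
  decode (suc f) n c = decodeTag f n (proj₁ (unpair c)) (proj₂ (unpair c))

  decodeTag : ℕ → (n : ℕ) → ℕ → ℕ → PR n
  decodeTag f n 0 r = zer
  decodeTag f n 1 r = succOr n
  decodeTag f n 2 r = projOr n r
  decodeTag f n 3 r =
    comp (decode f m (proj₁ (unpair r′))) (decodeVec f m n (proj₂ (unpair r′)))
    where
      m  = proj₁ (unpair r)
      r′ = proj₂ (unpair r)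
  decodeTag f zero    4 r = zer
  decodeTag f (suc n) 4 r =
    prec (decode f n (proj₁ (unpair r))) (decode f (suc (suc n)) (proj₂ (unpair r)))
  decodeTag f n (suc (suc (suc (suc (suc _))))) r = zer

  decodeVec : ℕ → (m n : ℕ) → ℕ → Vec (PR n) m
  decodeVec f zero    n c = []
  decodeVec f (suc m) n c =
    decode f n (proj₁ (unpair c)) ∷ decodeVec f m n (proj₂ (unpair c))

-- The (acceptable) numbering of r.e. sets:
--   W e = { y : ∃ s . φ(y , s) = 0 }  where φ is the PR term coded by e.

W : ℕ → ℕ → Set
W e y = ∃[ s ] eval (decode e 2 e) (y ∷ s ∷ []) ≡ 0

L : ℕ → ℕ → ℕ → Set
L e j x = W e (pair j x)

_≐_ : (ℕ → Set) → (ℕ → Set) → Set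
A ≐ B = ∀ x → (A x → B x) × (B x → A x)

data Len : Set where
  fin : ℕ → Len
  inf : Len

InDom : Len → ℕ → Set
InDom (fin n) i = i < n
InDom inf     i = ⊤

-- Uniformly r.e. positive teaching sequences.
-- The r.e. set W_w gives  F_i = { Sec w i j : j ∈ ℕ }, for i in the domain.

Sec : ℕ → ℕ → ℕ → ℕ → Set
Sec w i j x = W w (triple i j x)

-- (i) the F_i (nonempty automatically) form a partition of 𝓛_e
IsPartition : ℕ → Len → ℕ → Set
IsPartition e len w =
    (∀ i → InDom len i → ∀ j → ∃[ k ] (Sec w i j ≐ L e k))
  × (∀ k → ∃[ i ] (InDom len i × ∃[ j ] (L e k ≐ Sec w i j)))
  × (∀ i i′ → InDom len i → InDom len i′ → ∀ j j′ →
       Sec w i j ≐ Sec w i′ j′ → i ≡ i′)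

IsTeaching : Len → ℕ → (ℕ → ℕ) → Set
IsTeaching len w d =
  ∀ i → InDom len i → ∀ j →
    Σ (List ℕ) λ S →
        Unique S × length S ≡ d i × All (Sec w i j) S
      × (∀ i′ → InDom len i′ → i ≤ i′ → ∀ j′ →
           All (Sec w i′ j′) S → Sec w i j ≐ Sec w i′ j′)

IsUREPosTeachSeq : ℕ → Len → ℕ → (ℕ → ℕ) → Set
IsUREPosTeachSeq e len w d = IsPartition e len w × IsTeaching len w d

R⁺ure : ℕ → Set
R⁺ure e =
  Σ Len λ len → ∃[ w ] Σ (ℕ → ℕ) λ d →
    IsUREPosTeachSeq e len w d × ∃[ D ] (∀ i → InDom len i → d i ≤ D)

-- Σ⁰₅ definability (matrix primitive recursive, equivalent to recursive)

IsΣ⁰₅ : (ℕ → Set) → Set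
IsΣ⁰₅ P = Σ (PR 6) λ p → ∀ e →
  P e ⇔ (∃[ a ] ∀ b → ∃[ c ] ∀ d → ∃[ f ]
           eval p (e ∷ a ∷ b ∷ c ∷ d ∷ f ∷ []) ≡ 0)

{-# OPTIONS --safe #-}
module Submission where

-- Modulo the coding of the data (len, w, D) by numbers, R⁺ure e says that they exist with
-- properties which are all Π⁰₄: extensional equality of r.e. sets is Π⁰₂, so the two covering
-- conditions of a partition have the shape ∀∃Π⁰₂, and so does "every member of F_i has a teaching
-- set". The order function d is not quantified over: its value m ≤ D at i must serve all members
-- of F_i at once, and the bounded quantifier in "∀ i ∃ m ≤ D ∀ j …" is pushed inwards by
-- collection. The primitive recursive matrix comes from Kleene's normal form for W, obtained from
-- a stack machine that evaluates coded primitive recursive terms.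

open import Level using (0ℓ)
open import Axiom.ExcludedMiddle using (ExcludedMiddle)
open import Data.Bool using (Bool; true; false; not)
open import Data.Fin using (Fin; zero; suc; toℕ; #_)
open import Data.Fin.Properties using (toℕ-fromℕ<)
open import Data.List using (List; []; _∷_; length; applyUpTo)
open import Data.List.Properties using (length-applyUpTo)
open import Data.List.Relation.Unary.All using (All)
import Data.List.Relation.Unary.All.Properties as All
open import Data.List.Relation.Unary.AllPairs using (AllPairs; _∷_)
import Data.List.Relation.Unary.AllPairs.Properties as AllPairs
open import Data.List.Relation.Unary.Unique.Propositional using (Unique)
open import Data.Nat
open import Data.Nat.DivMod using (_mod_; _%_; [m+kn]%n≡m%n; m<n⇒m%n≡m; m%n<n)
open import Data.Nat.Properties
open import Data.Product using (∃; ∃-syntax; Σ; _×_; _,_; proj₁; proj₂)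
open import Data.Unit using (tt)
open import Data.Vec using (Vec; []; _∷_; lookup; head; tail; map)
open import Function using (_∘_; _⇔_; mk⇔; Equivalence)
open import Function.Construct.Composition using (_⇔-∘_)
open import Function.Construct.Identity using (⇔-id)
open import Relation.Binary.PropositionalEquality
  using (_≡_; _≢_; refl; sym; trans; cong; cong₂; subst; module ≡-Reasoning)
open import Relation.Nullary using (¬_; Dec; yes; no; contradiction)
open import Relation.Nullary.Decidable using (decidable-stable)
open import Defs

open Equivalence using (to; from)

-- Primitive recursive functions

-- Each term travels with the function it denotes, so that later proofs compute with `⟦_⟧` and meet
-- `eval` only through `sound`.
record Fn (n : ℕ) : Set where
  field
    ⟦_⟧   : Vec ℕ n → ℕ
    code  : PR n
    sound : ∀ v → eval code v ≡ ⟦_⟧ v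
open Fn using (⟦_⟧)

record Sub (m n : ℕ) : Set where
  field
    ⟦_⟧ₛ  : Vec ℕ m → Vec ℕ n
    codes : Vec (PR m) n
    sound : ∀ v → evalVec codes v ≡ ⟦_⟧ₛ v
open Sub using (⟦_⟧ₛ)

var : ∀ {n} → Fin n → Fn n
var i = record { ⟦_⟧ = λ v → lookup v i ; code = proj i ; sound = λ _ → refl }

infixr 5 _∷ₛ_
infixl 9 _[_]

_[_] : ∀ {m n} → Fn n → Sub m n → Fn m
F [ σ ] = record
  { ⟦_⟧   = λ v → ⟦ F ⟧ (⟦ σ ⟧ₛ v)
  ; code  = comp (Fn.code F) (Sub.codes σ)
  ; sound = λ v → trans (cong (eval (Fn.code F)) (Sub.sound σ v)) (Fn.sound F _)
  }

[]ₛ : ∀ {m} → Sub m 0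
[]ₛ = record { ⟦_⟧ₛ = λ _ → [] ; codes = [] ; sound = λ _ → refl }

_∷ₛ_ : ∀ {m n} → Fn m → Sub m n → Sub m (suc n)
F ∷ₛ σ = record
  { ⟦_⟧ₛ  = λ v → ⟦ F ⟧ v ∷ ⟦ σ ⟧ₛ v
  ; codes = Fn.code F ∷ Sub.codes σ
  ; sound = λ v → cong₂ _∷_ (Fn.sound F v) (Sub.sound σ v)
  }

projections : ∀ {m} n → (Fin n → Fin m) → Vec (PR m) n
projections zero    f = []
projections (suc n) f = proj (f zero) ∷ projections n (f ∘ suc)

eval-projections : ∀ {m n} (v : Vec ℕ m) (w : Vec ℕ n) (f : Fin n → Fin m) →
                   (∀ i → lookup v (f i) ≡ lookup w i) → evalVec (projections n f) v ≡ w
eval-projections v []      f eq = refl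
eval-projections v (x ∷ w) f eq =
  cong₂ _∷_ (eq zero) (eval-projections v w (f ∘ suc) (eq ∘ suc))

wk : ∀ {m n} → Sub m n → Sub (suc m) n
wk σ = record
  { ⟦_⟧ₛ  = λ v → ⟦ σ ⟧ₛ (tail v)
  ; codes = map (λ p → comp p (projections _ suc)) (Sub.codes σ)
  ; sound = λ { (x ∷ v) → trans (wk-sound (Sub.codes σ) x v) (Sub.sound σ v) }
  }
  where
  wk-sound : ∀ {m n} (ps : Vec (PR m) n) x v →
             evalVec (map (λ p → comp p (projections m suc)) ps) (x ∷ v) ≡ evalVec ps v
  wk-sound []       x v = refl
  wk-sound (p ∷ ps) x v =
    cong₂ _∷_ (cong (eval p) (eval-projections (x ∷ v) v suc (λ _ → refl))) (wk-sound ps x v)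

idₛ : ∀ {n} → Sub n n
idₛ = record
  { ⟦_⟧ₛ  = λ v → v
  ; codes = projections _ (λ i → i)
  ; sound = λ v → eval-projections v v (λ i → i) (λ _ → refl)
  }

infix 10 _↑

_↑ : ∀ {n} → Fn n → Fn (suc n)
F ↑ = F [ wk idₛ ]

lift : ∀ {m n} → Sub m n → Sub (suc m) (suc n)
lift σ = var zero ∷ₛ wk σ

natrec : ℕ → (ℕ → ℕ → ℕ) → ℕ → ℕ
natrec z s zero    = z
natrec z s (suc n) = s n (natrec z s n)

rec : ∀ {n} → Fn n → Fn (2 + n) → Fn (suc n)
rec G H = record
  { ⟦_⟧   = λ v → natrec (⟦ G ⟧ (tail v)) (λ x r → ⟦ H ⟧ (x ∷ r ∷ tail v)) (head v)
  ; code  = prec (Fn.code G) (Fn.code H)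
  ; sound = λ { (x ∷ v) → rec-sound x v }
  }
  where
  rec-sound : ∀ x v → eval (prec (Fn.code G) (Fn.code H)) (x ∷ v) ≡
              natrec (⟦ G ⟧ v) (λ x r → ⟦ H ⟧ (x ∷ r ∷ v)) x
  rec-sound zero    v = Fn.sound G v
  rec-sound (suc x) v =
    trans (cong (λ r → eval (Fn.code H) (x ∷ r ∷ v)) (rec-sound x v)) (Fn.sound H _)

-- Replaces the meaning given by the recursion with the intended `f`, so that goals show `pair` or
-- `nth` and not `natrec`.
fn₁ : (f : ℕ → ℕ) (F : Fn 1) → (∀ x → ⟦ F ⟧ (x ∷ []) ≡ f x) → ∀ {n} → Fn n → Fn n
fn₁ f F eq A = record
  { ⟦_⟧   = λ v → f (⟦ A ⟧ v)
  ; code  = Fn.code (F [ A ∷ₛ []ₛ ])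
  ; sound = λ v → trans (Fn.sound (F [ A ∷ₛ []ₛ ]) v) (eq _)
  }

fn₂ : (f : ℕ → ℕ → ℕ) (F : Fn 2) → (∀ x y → ⟦ F ⟧ (x ∷ y ∷ []) ≡ f x y) →
      ∀ {n} → Fn n → Fn n → Fn n
fn₂ f F eq A B = record
  { ⟦_⟧   = λ v → f (⟦ A ⟧ v) (⟦ B ⟧ v)
  ; code  = Fn.code (F [ A ∷ₛ B ∷ₛ []ₛ ])
  ; sound = λ v → trans (Fn.sound (F [ A ∷ₛ B ∷ₛ []ₛ ]) v) (eq _ _)
  }

zeroF : ∀ {n} → Fn n
zeroF = record { ⟦_⟧ = λ _ → 0 ; code = zer ; sound = λ _ → refl }

sucF : ∀ {n} → Fn n → Fn n
sucF = fn₁ suc (record { ⟦_⟧ = λ v → suc (head v) ; code = succ ; sound = λ { (x ∷ []) → refl } })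
           (λ _ → refl)

numeral : ∀ {n} → ℕ → Fn n
numeral k = record
  { ⟦_⟧   = λ _ → k
  ; code  = Fn.code (go k)
  ; sound = λ v → trans (Fn.sound (go k) v) (go-eq k v)
  }
  where
  go : ∀ {n} → ℕ → Fn n
  go zero    = zeroF
  go (suc k) = sucF (go k)
  go-eq : ∀ {n} k (v : Vec ℕ n) → ⟦ go k ⟧ v ≡ k
  go-eq zero    v = refl
  go-eq (suc k) v = cong suc (go-eq k v)

predF : ∀ {n} → Fn n → Fn n
predF = fn₁ pred (rec zeroF (var (# 0))) λ { zero → refl ; (suc _) → refl }

infixl 6 _+F_ _∸F_

_+F_ : ∀ {n} → Fn n → Fn n → Fn n
_+F_ = fn₂ _+_ (rec (var (# 0)) (sucF (var (# 1)))) eq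
  where
  eq : ∀ x y → natrec y (λ _ → suc) x ≡ x + y
  eq zero    y = refl
  eq (suc x) y = cong suc (eq x y)

_∸F_ : ∀ {n} → Fn n → Fn n → Fn n
-- `rec` recurses on the first argument, so the two arguments are swapped.
_∸F_ = fn₂ _∸_ (rec (var (# 0)) (predF (var (# 1))) [ var (# 1) ∷ₛ var (# 0) ∷ₛ []ₛ ]) eq
  where
  eq : ∀ x y → natrec x (λ _ → pred) y ≡ x ∸ y
  eq x zero    = refl
  eq x (suc y) = trans (cong pred (eq x y)) (pred[m∸n]≡m∸[1+n] x y)

if0_then_else_ : ℕ → ℕ → ℕ → ℕ
if0 zero  then x else y = x
if0 suc _ then x else y = y

if0F : ∀ {n} → Fn n → Fn n → Fn n → Fn n
if0F C A B = record
  { ⟦_⟧   = λ v → if0 ⟦ C ⟧ v then ⟦ A ⟧ v else ⟦ B ⟧ v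
  ; code  = Fn.code F
  ; sound = λ v → trans (Fn.sound F v) (eq (⟦ C ⟧ v) (⟦ A ⟧ v) (⟦ B ⟧ v))
  }
  where
  F = rec (var (# 0)) (var (# 3)) [ C ∷ₛ A ∷ₛ B ∷ₛ []ₛ ]
  eq : ∀ c x y → natrec x (λ _ _ → y) c ≡ if0 c then x else y
  eq zero    x y = refl
  eq (suc c) x y = refl

triF : ∀ {n} → Fn n → Fn n
triF = fn₁ tri (rec zeroF (var (# 1) +F sucF (var (# 0)))) eq
  where
  eq : ∀ x → natrec 0 (λ x r → r + suc x) x ≡ tri x
  eq zero    = refl
  eq (suc x) = cong (_+ suc x) (eq x)

pairF : ∀ {n} → Fn n → Fn n → Fn n
pairF = fn₂ pair (triF (var (# 0) +F var (# 1)) +F var (# 1)) (λ _ _ → refl)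

-- Inverting the pairing function; coded sequences

π₁ π₂ : ℕ → ℕ
π₁ n = proj₁ (unpair n)
π₂ n = proj₂ (unpair n)

-- Together with `pair-suc`: `pair` numbers the grid along the walk of `unpair`, through each
-- diagonal and from its end to the start of the next.
pair-suc-0 : ∀ x → pair (suc x) 0 ≡ suc (pair 0 x)
pair-suc-0 x rewrite +-identityʳ x = trans (+-identityʳ _) (+-suc (tri x) x)

pair-suc : ∀ x y → pair x (suc y) ≡ suc (pair (suc x) y)
pair-suc x y rewrite +-suc x y = +-suc _ y

-- The induction goes back along the walk, hence on the value `n`: the predecessor of a point may
-- have a larger coordinate.
unpair-inverse : ∀ n x y → pair x y ≡ n → unpair n ≡ (x , y)
unpair-inverse zero    zero    zero    eq = refl
unpair-inverse zero    (suc x) zero    eq = contradiction (trans (sym (pair-suc-0 x)) eq) λ ()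
unpair-inverse zero    x       (suc y) eq = contradiction (trans (sym (pair-suc x y)) eq) λ ()
unpair-inverse (suc n) (suc x) zero    eq
  rewrite unpair-inverse n 0 x (suc-injective (trans (sym (pair-suc-0 x)) eq)) = refl
unpair-inverse (suc n) x       (suc y) eq
  rewrite unpair-inverse n (suc x) y (suc-injective (trans (sym (pair-suc x y)) eq)) = refl

unpair-pair : ∀ x y → unpair (pair x y) ≡ (x , y)
unpair-pair x y = unpair-inverse _ x y refl

π₁-pair : ∀ x y → π₁ (pair x y) ≡ x
π₁-pair x y = cong proj₁ (unpair-pair x y)

π₂-pair : ∀ x y → π₂ (pair x y) ≡ y
π₂-pair x y = cong proj₂ (unpair-pair x y)

pair-unpair : ∀ n → pair (π₁ n) (π₂ n) ≡ n
pair-unpair zero = refl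
pair-unpair (suc n) with unpair n | pair-unpair n
... | zero  , y | eq = trans (pair-suc-0 y) (cong suc eq)
... | suc x , y | eq = trans (pair-suc x y) (cong suc eq)

-- The index x + y of the diagonal of pair x y: the largest r with tri r ≤ n.
diagonal : ℕ → ℕ
diagonal = natrec 0 λ n r → if0 tri (suc r) ∸ suc n then suc r else r

diagonal-unpair : ∀ n → diagonal n ≡ π₁ n + π₂ n
diagonal-unpair zero = refl
diagonal-unpair (suc n) with unpair n | pair-unpair n | diagonal n | diagonal-unpair n
-- At the end of diagonal `y`, `suc n` equals `tri (suc y)`, so the index grows.
... | zero  , y | refl | _ | refl
  rewrite m≤n⇒m∸n≡0 (≤-reflexive (+-suc (tri y) y)) = sym (cong suc (+-identityʳ y))
-- Inside a diagonal the tested difference is `suc x`, so the index stays.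
... | suc x , y | refl | _ | refl = begin
  if0 tri r + suc r ∸ suc (tri r + y) then suc r else r
    ≡⟨ cong (λ z → if0 z ∸ suc (tri r + y) then suc r else r) (+-suc (tri r) r) ⟩
  if0 (tri r + r) ∸ (tri r + y) then suc r else r
    ≡⟨ cong (if0_then suc r else r) ([m+n]∸[m+o]≡n∸o (tri r) r y) ⟩
  if0 (suc x + y) ∸ y then suc r else r
    ≡⟨ cong (if0_then suc r else r) (m+n∸n≡m (suc x) y) ⟩
  suc x + y
    ≡⟨ +-suc x y ⟨
  x + suc y ∎
  where
  open ≡-Reasoning
  r = suc x + y

diagonalF : ∀ {n} → Fn n → Fn n
diagonalF = fn₁ diagonal
  (rec zeroF (if0F (triF (sucF (var (# 1))) ∸F sucF (var (# 0))) (sucF (var (# 1))) (var (# 1))))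
  (λ _ → refl)

-- `unpair` recurses with a pair as value, so the components are read off the diagonal index
-- instead: `n` is `tri (x + y) + y`.
π₂F : ∀ {n} → Fn n → Fn n
π₂F = fn₁ π₂ (var (# 0) ∸F triF (diagonalF (var (# 0)))) eq
  where
  eq : ∀ n → n ∸ tri (diagonal n) ≡ π₂ n
  eq n rewrite diagonal-unpair n =
    trans (cong (_∸ tri (π₁ n + π₂ n)) (sym (pair-unpair n))) (m+n∸m≡n (tri (π₁ n + π₂ n)) (π₂ n))

π₁F : ∀ {n} → Fn n → Fn n
π₁F = fn₁ π₁ (diagonalF (var (# 0)) ∸F π₂F (var (# 0))) eq
  where
  eq : ∀ n → diagonal n ∸ π₂ n ≡ π₁ n
  eq n rewrite diagonal-unpair n = m+n∸n≡m (π₁ n) (π₂ n)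

-- Every number is read as an infinite sequence, so no length or well-formedness has to be coded.
nth : ℕ → ℕ → ℕ
nth s zero    = π₁ s
nth s (suc k) = nth (π₂ s) k

nthF : ∀ {n} → Fn n → Fn n → Fn n
nthF = fn₂ nth (π₁F (rec (var (# 0)) (π₂F (var (# 1))) [ var (# 1) ∷ₛ var (# 0) ∷ₛ []ₛ ])) eq
  where
  drop : ℕ → ℕ → ℕ
  drop s = natrec s (λ _ → π₂)
  drop-suc : ∀ s k → drop s (suc k) ≡ drop (π₂ s) k
  drop-suc s zero    = refl
  drop-suc s (suc k) = cong π₂ (drop-suc s k)
  eq : ∀ s k → π₁ (drop s k) ≡ nth s k
  eq s zero    = refl
  eq s (suc k) = trans (cong π₁ (drop-suc s k)) (eq (π₂ s) k)

-- The divisor is suc n.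
remainder : ℕ → ℕ → ℕ
remainder n = natrec 0 λ _ r → if0 n ∸ r then 0 else suc r

remainder-spec : ∀ n m → ∃[ q ] (remainder n m ≤ n × m ≡ remainder n m + q * suc n)
remainder-spec n zero = 0 , z≤n , refl
remainder-spec n (suc m) with remainder-spec n m | n ∸ remainder n m in d
-- The counter has reached `n`: it restarts at 0 and the quotient grows.
... | q , r≤n , eq | zero =
  suc q , z≤n , cong suc (trans eq (cong (_+ q * suc n) (≤-antisym r≤n (m∸n≡0⇒m≤n d))))
... | q , r≤n , eq | suc _ =
  q , m∸n≢0⇒n<m (λ p → contradiction (trans (sym d) p) λ ()) , cong suc eq

remainder-% : ∀ n m → remainder n m ≡ m % suc n
remainder-% n m =
  let q , r≤n , eq = remainder-spec n m in
  sym (trans (cong (_% suc n) eq)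
      (trans ([m+kn]%n≡m%n (remainder n m) q (suc n)) (m<n⇒m%n≡m (s≤s r≤n))))

remainderF : ∀ {n} → Fn n → Fn n → Fn n
remainderF = fn₂ remainder
  (rec zeroF (if0F (var (# 2) ∸F var (# 1)) zeroF (sucF (var (# 1)))) [ var (# 1) ∷ₛ var (# 0) ∷ₛ []ₛ ])
  (λ _ _ → refl)

-- Kleene's normal form

switch : ∀ {n} → Fn n → List (Fn n) → Fn n → Fn n
switch T []       D = D
switch T (B ∷ Bs) D = if0F T B (switch (predF T) Bs D)

task : (t a b c d e : ℕ) → ℕ
task t a b c d e = pair t (pair a (pair b (pair c (pair d e))))

taskF : ∀ {k} (t a b c d e : Fn k) → Fn k
taskF t a b c d e = pairF t (pairF a (pairF b (pairF c (pairF d e))))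

goto : (r t s : ℕ) → ℕ
goto r t s = pair r (pair t s)

gotoF : ∀ {k} (r t s : Fn k) → Fn k
gotoF r t s = pairF r (pairF t s)

-- A machine state is pair r (stack of tasks), with r the value returned last. Eval and EvalVec
-- start the evaluation of decode f n c and decodeVec f m n c at v; Args and Cons continue with
-- the tail of a vector and with consing on its head; Call applies a term to the returned vector;
-- Recurse performs the successor step of a primitive recursion whose value at x was returned.
Eval : (f n c v : ℕ) → ℕ
Eval f n c v = task 1 f n c v 0

EvalVec Args : (f m n c v : ℕ) → ℕ
EvalVec = task 2
Args    = task 3

Cons : (x : ℕ) → ℕ
Cons x = task 4 x 0 0 0 0

Call : (f m c : ℕ) → ℕ
Call f m c = task 5 f m c 0 0

Recurse : (f n c x v : ℕ) → ℕ
Recurse = task 6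

EvalF : ∀ {k} (f n c v : Fn k) → Fn k
EvalF f n c v = taskF (numeral 1) f n c v zeroF

EvalVecF ArgsF RecurseF : ∀ {k} (f m n c v : Fn k) → Fn k
EvalVecF = taskF (numeral 2)
ArgsF    = taskF (numeral 3)
RecurseF = taskF (numeral 6)

ConsF : ∀ {k} (x : Fn k) → Fn k
ConsF x = taskF (numeral 4) x zeroF zeroF zeroF zeroF

CallF : ∀ {k} (f m c : Fn k) → Fn k
CallF f m c = taskF (numeral 5) f m c zeroF zeroF

-- The code c = pair t q and the vector v = pair h l are passed already unpaired.
evalStep : Fn 10
evalStep = switch t
  -- One branch per tag of `decodeTag`, in its order; ill-formed codes return 0, the value of `zer`.
  ( ret zeroF
  ∷ if0F n (ret zeroF) (if0F (predF n) (ret (sucF h)) (ret zeroF))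
  ∷ if0F n (ret zeroF) (ret (nthF v (remainderF (predF n) q)))
  ∷ gotoF r (EvalVecF f (π₁F q) n (π₂F (π₂F q)) v) (pairF (CallF f (π₁F q) (π₁F (π₂F q))) s)
  ∷ if0F n (ret zeroF)
      (if0F h (gotoF r (EvalF f (predF n) (π₁F q) l) s)
              -- The same term is evaluated again at the predecessor, so the fuel, already decreased
              -- to `f`, is restored.
              (gotoF r (EvalF (sucF f) n c (pairF (predF h) l))
                       (pairF (RecurseF f (sucF n) (π₂F q) (predF h) l) s)))
  ∷ []) (ret zeroF)
  where
  r = var (# 0)
  s = var (# 1)
  f = var (# 2)
  n = var (# 3)
  c = var (# 4)
  v = var (# 5)
  t = var (# 6)
  q = var (# 7)
  h = var (# 8)
  l = var (# 9)
  ret : Fn 10 → Fn 10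
  ret x = pairF x s

taskStep : Fn 8
taskStep = switch t
  -- The empty stack 0 unpairs to tag 0 and rest 0, so this branch makes halted states fixed points.
  ( pairF r s
  ∷ if0F a (pairF zeroF s)
      (evalStep [ r ∷ₛ s ∷ₛ predF a ∷ₛ b ∷ₛ c ∷ₛ d ∷ₛ π₁F c ∷ₛ π₂F c ∷ₛ π₁F d ∷ₛ π₂F d ∷ₛ []ₛ ])
  -- The 0 returned here is the code of the empty vector.
  ∷ if0F b (pairF zeroF s)
      (gotoF r (EvalF a c (π₁F d) e) (pairF (ArgsF a (predF b) c (π₂F d) e) s))
  ∷ gotoF r (EvalVecF a b c d e) (pairF (ConsF r) s)
  ∷ pairF (pairF a r) s
  ∷ gotoF r (EvalF a b c r) s
  ∷ []) (gotoF r (EvalF a b c (pairF d (pairF r e))) s)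
  where
  r = var (# 0)
  s = var (# 1)
  t = var (# 2)
  a = var (# 3)
  b = var (# 4)
  c = var (# 5)
  d = var (# 6)
  e = var (# 7)

fields : Sub 1 8
fields = π₁F x ∷ₛ π₂F (π₂F x) ∷ₛ π₁F t₀ ∷ₛ π₁F t₁ ∷ₛ π₁F t₂ ∷ₛ π₁F t₃ ∷ₛ π₁F t₄ ∷ₛ π₂F t₄ ∷ₛ []ₛ
  where
  x  = var (# 0)
  t₀ = π₁F (π₂F x)
  t₁ = π₂F t₀
  t₂ = π₂F t₁
  t₃ = π₂F t₂
  t₄ = π₂F t₃

stepF : Fn 1
stepF = taskStep [ fields ]

-- Equations about `unpair` cover both a genuine task and the empty stack, which is not built by
-- `task`.
fields-unpair : ∀ x {r y k s t a b c d e t₁ t₂ t₃ t₄} →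
  unpair x ≡ (r , y) → unpair y ≡ (k , s) → unpair k ≡ (t , t₁) → unpair t₁ ≡ (a , t₂) →
  unpair t₂ ≡ (b , t₃) → unpair t₃ ≡ (c , t₄) → unpair t₄ ≡ (d , e) →
  ⟦ fields ⟧ₛ (x ∷ []) ≡ r ∷ s ∷ t ∷ a ∷ b ∷ c ∷ d ∷ e ∷ []
fields-unpair x p₁ p₂ p₃ p₄ p₅ p₆ p₇
  rewrite p₁ | p₂ | p₃ | p₄ | p₅ | p₆ | p₇ = refl

fields-task : ∀ r s t a b c d e →
  ⟦ fields ⟧ₛ (goto r (task t a b c d e) s ∷ []) ≡ r ∷ s ∷ t ∷ a ∷ b ∷ c ∷ d ∷ e ∷ []
fields-task r s t a b c d e =
  fields-unpair (pair r (pair t₀ s)) (unpair-pair r (pair t₀ s)) (unpair-pair t₀ s)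
                (unpair-pair t t₁) (unpair-pair a t₂) (unpair-pair b t₃) (unpair-pair c t₄) (unpair-pair d e)
  where
  t₄ = pair d e
  t₃ = pair c t₄
  t₂ = pair b t₃
  t₁ = pair a t₂
  t₀ = pair t t₁

-- Opaque, since unification would otherwise unfold the whole step function.
opaque
  step : ℕ → ℕ
  step x = ⟦ stepF ⟧ (x ∷ [])

  step-task : ∀ r s t a b c d e →
    step (goto r (task t a b c d e) s) ≡ ⟦ taskStep ⟧ (r ∷ s ∷ t ∷ a ∷ b ∷ c ∷ d ∷ e ∷ [])
  step-task r s t a b c d e = cong ⟦ taskStep ⟧ (fields-task r s t a b c d e)

  step-empty : ∀ r → step (pair r 0) ≡ pair r 0
  step-empty r = cong ⟦ taskStep ⟧
    (fields-unpair (pair r 0) (unpair-pair r 0) refl refl refl refl refl refl)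

  ⟦stepF⟧ : ∀ x → ⟦ stepF ⟧ (x ∷ []) ≡ step x
  ⟦stepF⟧ x = refl

-- With the tag and the head given through equations, callers can supply constructors on which the
-- case distinctions reduce.
step-eval : ∀ r s f n c v t h l → π₁ c ≡ t → π₁ v ≡ h → π₂ v ≡ l →
  step (goto r (Eval (suc f) n c v) s) ≡
  ⟦ evalStep ⟧ (r ∷ s ∷ f ∷ n ∷ c ∷ v ∷ t ∷ π₂ c ∷ h ∷ l ∷ [])
step-eval r s f n c v t h l refl refl refl = step-task r s 1 (suc f) n c v 0

-- Runs of the machine and their correctness

run : ℕ → ℕ → ℕ
run x = natrec x (λ _ → step)

infix 4 _↠_
record _↠_ (x y : ℕ) : Set where
  constructor _,_
  field
    time    : ℕ
    reaches : run x time ≡ y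

run-+ : ∀ x j k → run x (j + k) ≡ run (run x k) j
run-+ x zero    k = refl
run-+ x (suc j) k = cong step (run-+ x j k)

↠-trans : ∀ {x y z} → x ↠ y → y ↠ z → x ↠ z
↠-trans {x} (k , p) (j , q) = j + k , trans (run-+ x j k) (trans (cong (λ y → run y j) p) q)

↠-step : ∀ {x y z} → step x ≡ y → y ↠ z → x ↠ z
↠-step p = ↠-trans (1 , p)

↠-last : ∀ {x y} → step x ≡ y → x ↠ y
↠-last p = 1 , p

run-fixed : ∀ {x} → step x ≡ x → ∀ k → run x k ≡ x
run-fixed eq zero    = refl
run-fixed eq (suc k) = trans (cong step (run-fixed eq k)) eq

-- Fixed points absorb further steps, so the run of length `j + k` ends in both `y` and `z`.
↠-fixed-unique : ∀ {x y z} → x ↠ y → step y ≡ y → x ↠ z → step z ≡ z → y ≡ z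
↠-fixed-unique {x} {y} {z} (j , p) fy (k , q) fz = begin
  y             ≡⟨ run-fixed fy k ⟨
  run y k       ≡⟨ cong (λ u → run u k) p ⟨
  run (run x j) k ≡⟨ run-+ x k j ⟨
  run x (k + j) ≡⟨ cong (run x) (+-comm k j) ⟩
  run x (j + k) ≡⟨ run-+ x j k ⟩
  run (run x k) j ≡⟨ cong (λ u → run u j) q ⟩
  run z j       ≡⟨ run-fixed fz j ⟩
  z             ∎
  where open ≡-Reasoning

encode : ∀ {n} → Vec ℕ n → ℕ
encode []      = 0
encode (x ∷ v) = pair x (encode v)

nth-lookup : ∀ {n} (v : Vec ℕ n) i → nth (encode v) (toℕ i) ≡ lookup v i
nth-lookup (x ∷ v) zero    = π₁-pair x (encode v)
nth-lookup (x ∷ v) (suc i) =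
  trans (cong (λ s → nth s (toℕ i)) (π₂-pair x (encode v))) (nth-lookup v i)

nth-remainder : ∀ {n} (v : Vec ℕ (suc n)) q →
                nth (encode v) (remainder n q) ≡ lookup v (q mod suc n)
nth-remainder {n} v q =
  trans (cong (nth (encode v)) (trans (remainder-% n q) (sym (toℕ-fromℕ< (m%n<n q (suc n))))))
        (nth-lookup v (q mod suc n))

-- Simultaneous induction on the fuel, then on the vector length or the recursion argument. The
-- stack `s` is arbitrary because subterms are evaluated above pending tasks.
↠-decode : ∀ f n c (v : Vec ℕ n) r s →
           goto r (Eval f n c (encode v)) s ↠ pair (eval (decode f n c) v) s

-- The tag is a separate argument so that it can be matched on while the task keeps the code `c`.
↠-decodeTag : ∀ f n c t (v : Vec ℕ n) r s → π₁ c ≡ t →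
              goto r (Eval (suc f) n c (encode v)) s ↠ pair (eval (decodeTag f n t (π₂ c)) v) s

↠-decodeVec : ∀ f m n c (v : Vec ℕ n) r s →
              goto r (EvalVec f m n c (encode v)) s ↠ pair (encode (evalVec (decodeVec f m n c) v)) s

↠-decode zero    n c v r s = ↠-last (step-task r s 1 0 n c (encode v) 0)
↠-decode (suc f) n c v r s = ↠-decodeTag f n c (π₁ c) v r s refl

↠-decodeTag f n c 0 v r s eq =
  ↠-last (step-eval r s f n c (encode v) _ _ _ eq refl refl)
↠-decodeTag f zero c 1 v r s eq =
  ↠-last (step-eval r s f 0 c (encode v) _ _ _ eq refl refl)
↠-decodeTag f (suc zero) c 1 (x ∷ []) r s eq =
  ↠-last (step-eval r s f 1 c (pair x 0) _ _ _ eq (π₁-pair x 0) refl)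
↠-decodeTag f (suc (suc n)) c 1 v r s eq =
  ↠-last (step-eval r s f (2 + n) c (encode v) _ _ _ eq refl refl)
↠-decodeTag f zero c 2 v r s eq =
  ↠-last (step-eval r s f 0 c (encode v) _ _ _ eq refl refl)
↠-decodeTag f (suc n) c 2 v r s eq =
  ↠-last (trans (step-eval r s f (suc n) c (encode v) _ _ _ eq refl refl)
                (cong (λ x → pair x s) (nth-remainder v (π₂ c))))
↠-decodeTag f n c 3 v r s eq =
  ↠-step (step-eval r s f n c (encode v) _ _ _ eq refl refl)
  (↠-trans (↠-decodeVec f m n (π₂ (π₂ q)) v r _)
  (↠-step (step-task (encode ws) s 5 f m (π₁ (π₂ q)) 0 0)
  (↠-decode f m (π₁ (π₂ q)) ws (encode ws) s)))
  where
  q  = π₂ c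
  m  = π₁ q
  ws = evalVec (decodeVec f m n (π₂ (π₂ q))) v
↠-decodeTag f zero c 4 v r s eq =
  ↠-last (step-eval r s f 0 c (encode v) _ _ _ eq refl refl)
↠-decodeTag f (suc n) c 4 (zero ∷ v) r s eq =
  ↠-step (step-eval r s f (suc n) c (pair 0 (encode v)) _ _ _ eq
                     (π₁-pair 0 (encode v)) (π₂-pair 0 (encode v)))
  (↠-decode f n (π₁ (π₂ c)) v r s)
↠-decodeTag f (suc n) c 4 (suc x ∷ v) r s eq =
  ↠-step (step-eval r s f (suc n) c (pair (suc x) (encode v)) _ _ _ eq
                     (π₁-pair (suc x) (encode v)) (π₂-pair (suc x) (encode v)))
  (↠-trans (↠-decodeTag f (suc n) c 4 (x ∷ v) r _ eq)
  (↠-step (step-task y s 6 f (2 + n) (π₂ (π₂ c)) x (encode v))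
  (↠-decode f (2 + n) (π₂ (π₂ c)) (x ∷ y ∷ v) y s)))
  where
  y = eval (decodeTag f (suc n) 4 (π₂ c)) (x ∷ v)
↠-decodeTag f zero c (suc (suc (suc (suc (suc t))))) v r s eq =
  ↠-last (step-eval r s f zero c (encode v) _ _ _ eq refl refl)
↠-decodeTag f (suc n) c (suc (suc (suc (suc (suc t))))) v r s eq =
  ↠-last (step-eval r s f (suc n) c (encode v) _ _ _ eq refl refl)

↠-decodeVec f zero    n c v r s = ↠-last (step-task r s 2 f 0 n c (encode v))
↠-decodeVec f (suc m) n c v r s =
  ↠-step (step-task r s 2 f (suc m) n c (encode v))
  (↠-trans (↠-decode f n (π₁ c) v r _)
  (↠-step (step-task x s 3 f m n (π₂ c) (encode v))
  (↠-trans (↠-decodeVec f m n (π₂ c) v x _)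
  (↠-last (step-task (encode (evalVec (decodeVec f m n (π₂ c)) v)) s 4 x 0 0 0 0)))))
  where
  x = eval (decode f n (π₁ c)) v

natrec-cong : ∀ z {s s′} → (∀ n r → s n r ≡ s′ n r) → ∀ n → natrec z s n ≡ natrec z s′ n
natrec-cong z             eq zero    = refl
natrec-cong z {s′ = s′} eq (suc n) = trans (eq n _) (cong (s′ n) (natrec-cong z eq n))

runF : Fn 4
-- The code `e` is also its own fuel and the arity is 2, as in `W`.
runF = rec (gotoF zeroF (EvalF (var (# 0)) (numeral 2) (var (# 0))
                               (pairF (var (# 1)) (pairF (var (# 2)) zeroF))) zeroF)
           (stepF [ var (# 1) ∷ₛ []ₛ ])

-- The number t codes a run time and the search variable of W. A machine with empty stack and
-- result 0 is in state pair 0 0 = 0.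
opaque
  accepts : ℕ → ℕ → ℕ → ℕ
  accepts e y t = run (goto 0 (Eval e 2 e (encode (y ∷ π₂ t ∷ []))) 0) (π₁ t)

  ⟦runF⟧ : ∀ e y t → ⟦ runF ⟧ (π₁ t ∷ e ∷ y ∷ π₂ t ∷ []) ≡ accepts e y t
  ⟦runF⟧ e y t = natrec-cong _ (λ _ → ⟦stepF⟧) (π₁ t)

  W⇔accepts : ∀ e y → W e y ⇔ (∃[ t ] accepts e y t ≡ 0)
  W⇔accepts e y = mk⇔ accepted member
    where
    halts : ∀ s → goto 0 (Eval e 2 e (encode (y ∷ s ∷ []))) 0 ↠ pair (eval (decode e 2 e) (y ∷ s ∷ [])) 0
    halts s = ↠-decode e 2 e (y ∷ s ∷ []) 0 0
    accepted : W e y → ∃[ t ] accepts e y t ≡ 0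
    accepted (s , p) = let k , q = halts s in
      pair k s , trans (cong₂ (λ s k → run (goto 0 (Eval e 2 e (encode (y ∷ s ∷ []))) 0) k)
                              (π₂-pair k s) (π₁-pair k s))
                       (trans q (cong (λ x → pair x 0) p))
    member : ∃[ t ] accepts e y t ≡ 0 → W e y
    -- The accepting state and the state holding the value of the term are halted and reached from
    -- the same start, so they agree.
    member (t , p) = π₂ t ,
      trans (sym (π₁-pair (eval (decode e 2 e) (y ∷ π₂ t ∷ [])) 0))
            (cong π₁ (↠-fixed-unique (halts (π₂ t))
                                       (step-empty (eval (decode e 2 e) (y ∷ π₂ t ∷ [])))
                                       (π₁ t , p) (step-empty 0)))

acceptsF : ∀ {k} (e y t : Fn k) → Fn k
acceptsF e y t = record
  { ⟦_⟧   = λ v → accepts (⟦ e ⟧ v) (⟦ y ⟧ v) (⟦ t ⟧ v)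
  ; code  = Fn.code (runF [ σ ])
  ; sound = λ v → trans (Fn.sound (runF [ σ ]) v) (⟦runF⟧ (⟦ e ⟧ v) (⟦ y ⟧ v) (⟦ t ⟧ v))
  }
  where
  σ = π₁F t ∷ₛ e ∷ₛ y ∷ₛ π₂F t ∷ₛ []ₛ

-- The arithmetical hierarchy

Rel : ℕ → Set₁
Rel n = Vec ℕ n → Set

Quant : Bool → (ℕ → Set) → Set
Quant true  A = ∃ A
Quant false A = ∀ x → A x

Quant-cong : ∀ b {A B : ℕ → Set} → (∀ x → A x ⇔ B x) → Quant b A ⇔ Quant b B
Quant-cong true  A⇔B = mk⇔ (λ (x , a) → x , to (A⇔B x) a) (λ (x , b) → x , from (A⇔B x) b)
Quant-cong false A⇔B = mk⇔ (λ f x → to (A⇔B x) (f x)) (λ f x → from (A⇔B x) (f x))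

-- Arith true k and Arith false k are the classes Σ⁰ₖ and Π⁰ₖ.
data Arith : ∀ {n} → Bool → ℕ → Rel n → Set₁ where
  matrix : ∀ {n b} {P : Rel n} (F : Fn n) → (∀ v → P v ⇔ ⟦ F ⟧ v ≡ 0) → Arith b 0 P
  quant  : ∀ {n b k} {P : Rel n} {Q : Rel (suc n)} → Arith (not b) k Q →
           (∀ v → P v ⇔ Quant b (λ x → Q (x ∷ v))) → Arith b (suc k) P

resp : ∀ {n b k} {P P′ : Rel n} → (∀ v → P′ v ⇔ P v) → Arith b k P → Arith b k P′
resp eq (matrix F p) = matrix F (λ v → p v ⇔-∘ eq v)
resp eq (quant q p)  = quant q (λ v → p v ⇔-∘ eq v)

substitute : ∀ {m n b k} {P : Rel n} (σ : Sub m n) → Arith b k P → Arith b k (λ v → P (⟦ σ ⟧ₛ v))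
substitute σ (matrix F p) = matrix (F [ σ ]) (λ v → p (⟦ σ ⟧ₛ v))
substitute σ (quant q p)  = quant (substitute (lift σ) q) (λ v → p (⟦ σ ⟧ₛ v))

-- The vacuous quantifier goes in front, which changes the kind of the class.
dummy : ∀ {n b k} {P : Rel n} → Arith b k P → Arith (not b) (suc k) P
dummy {b = true}  a = quant (substitute (wk idₛ) a) (λ v → mk⇔ (λ p _ → p) (λ f → f 0))
dummy {b = false} a = quant (substitute (wk idₛ) a) (λ v → mk⇔ (0 ,_) proj₂)

-- The vacuous quantifier goes next to the matrix, so the leading quantifier keeps its kind.
raise : ∀ {n b k} {P : Rel n} → Arith b k P → Arith b (suc k) P
raise {b = true}  (matrix F p) = dummy (matrix {b = false} F p)
raise {b = false} (matrix F p) = dummy (matrix {b = true} F p)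
raise             (quant q p)  = quant (raise q) p

atom : ∀ {n b k} {P : Rel n} → Arith b 0 P → Arith b k P
atom {k = zero}  a = a
atom {k = suc k} a = raise (atom a)

infixr 6 _∧_

-- The prefixes merge level by level: one number is read as a pair with a component for each
-- conjunct. A sum vanishes iff both matrices do.
_∧_ : ∀ {n b k} {P Q : Rel n} → Arith b k P → Arith b k Q → Arith b k (λ v → P v × Q v)
matrix F p ∧ matrix G q = matrix (F +F G) λ v → mk⇔
  (λ (x , y) → cong₂ _+_ (to (p v) x) (to (q v) y))
  (λ eq → from (p v) (m+n≡0⇒m≡0 (⟦ F ⟧ v) eq) , from (q v) (m+n≡0⇒n≡0 (⟦ F ⟧ v) eq))
_∧_ {b = b} (quant p p⇔) (quant q q⇔) =
  quant (substitute (π₁F (var zero) ∷ₛ wk idₛ) p ∧ substitute (π₂F (var zero) ∷ₛ wk idₛ) q)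
        (λ v → merge b ⇔-∘ ×-cong (p⇔ v) (q⇔ v))
  where
  ×-cong : ∀ {A A′ B B′ : Set} → A ⇔ A′ → B ⇔ B′ → (A × B) ⇔ (A′ × B′)
  ×-cong f g = mk⇔ (λ (x , y) → to f x , to g y) (λ (x , y) → from f x , from g y)
  merge : ∀ b {A B : ℕ → Set} → (Quant b A × Quant b B) ⇔ Quant b (λ z → A (π₁ z) × B (π₂ z))
  merge true {A} {B} = mk⇔
    (λ ((x , a) , (y , b)) → pair x y ,
      subst A (sym (π₁-pair x y)) a , subst B (sym (π₂-pair x y)) b)
    (λ (z , a , b) → (π₁ z , a) , (π₂ z , b))
  merge false {A} {B} = mk⇔
    (λ (f , g) z → f (π₁ z) , g (π₂ z))
    (λ h → (λ x → subst A (π₁-pair x 0) (proj₁ (h (pair x 0)))) ,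
           (λ y → subst B (π₂-pair 0 y) (proj₂ (h (pair 0 y)))))

-- Contracting two like quantifiers into one over pairs keeps the level. The inner variable stands
-- first in the environment, so it receives `π₂`.
quantify : ∀ {n} b {k} {Q : Rel (suc n)} → Arith b (suc k) Q →
           Arith b (suc k) (λ v → Quant b (λ x → Q (x ∷ v)))
quantify b (quant q q⇔) =
  quant (substitute (π₂F (var zero) ∷ₛ π₁F (var zero) ∷ₛ wk idₛ) q)
        (λ v → merge b ⇔-∘ Quant-cong b (λ x → q⇔ (x ∷ v)))
  where
  merge : ∀ b {A : ℕ → ℕ → Set} → Quant b (λ x → Quant b (A x)) ⇔ Quant b (λ z → A (π₁ z) (π₂ z))
  merge true {A} = mk⇔
    (λ (x , y , a) → pair x y ,
      subst (A (π₁ (pair x y))) (sym (π₂-pair x y)) (subst (λ u → A u y) (sym (π₁-pair x y)) a))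
    (λ (z , a) → π₁ z , π₂ z , a)
  merge false {A} = mk⇔
    (λ f z → f (π₁ z) (π₂ z))
    (λ f x y → subst (A x) (π₂-pair x y)
      (subst (λ u → A u (π₂ (pair x y))) (π₁-pair x y) (f (pair x y))))

≤-arith : ∀ {n b} (F G : Fn n) → Arith b 0 (λ v → ⟦ F ⟧ v ≤ ⟦ G ⟧ v)
≤-arith F G = matrix (F ∸F G) (λ v → mk⇔ m≤n⇒m∸n≡0 m∸n≡0⇒m≤n)

≡-arith : ∀ {n b} (F G : Fn n) → Arith b 0 (λ v → ⟦ F ⟧ v ≡ ⟦ G ⟧ v)
≡-arith F G = resp (λ v → mk⇔ (λ eq → ≤-reflexive eq , ≤-reflexive (sym eq)) (λ (p , q) → ≤-antisym p q))
                   (≤-arith F G ∧ ≤-arith G F)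

-- Closure under negation, implication and bounded quantifiers

module Classical (em : ExcludedMiddle 0ℓ) where

  stable : ∀ {A : Set} → ¬ ¬ A → A
  stable = decidable-stable em

  ¬-Quant : ∀ b {A : ℕ → Set} → (¬ Quant b A) ⇔ Quant (not b) (λ x → ¬ A x)
  ¬-Quant true  = mk⇔ (λ f x a → f (x , a)) (λ f (x , a) → f x a)
  ¬-Quant false = mk⇔ (λ f → stable (λ g → f (λ x → stable (λ ¬a → g (x , ¬a)))))
                      (λ (x , ¬a) f → ¬a (f x))

  ¬-cong : ∀ {A B : Set} → A ⇔ B → (¬ A) ⇔ (¬ B)
  ¬-cong f = mk⇔ (_∘ from f) (_∘ to f)

  ~_ : ∀ {n b k} {P : Rel n} → Arith b k P → Arith (not b) k (λ v → ¬ P v)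
  ~ matrix F p = matrix (if0F F (sucF zeroF) zeroF) (λ v → flip (⟦ F ⟧ v) ⇔-∘ ¬-cong (p v))
    where
    flip : ∀ m → (¬ m ≡ 0) ⇔ (if0 m then 1 else 0) ≡ 0
    flip zero    = mk⇔ (λ f → contradiction refl f) λ ()
    flip (suc _) = mk⇔ (λ _ → refl) (λ _ ())
  ~_ {b = b} (quant q q⇔) = quant (~ q) (λ v → ¬-Quant b ⇔-∘ ¬-cong (q⇔ v))

  infixr 5 _⇒_

  -- Read as the negation of `P` and not `Q`, a conjunction of two Σ conditions.
  _⇒_ : ∀ {n k} {P Q : Rel n} → Arith true k P → Arith false k Q → Arith false k (λ v → P v → Q v)
  p ⇒ q = resp (λ v → mk⇔ (λ f (a , ¬b) → ¬b (f a)) (λ g a → stable (λ ¬b → g (a , ¬b)))) (~ (p ∧ ~ q))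

  -- Index 0 is split off, not the last one, because coded sequences grow at the head.
  collect : ∀ m {R : ℕ → ℕ → Set} → (∀ k → k < m → ∃[ t ] R t k) → ∃[ s ] (∀ k → k < m → R (nth s k) k)
  collect zero    f = 0 , λ _ ()
  collect (suc m) {R} f with f 0 z<s | collect m (λ k k<m → f (suc k) (s<s k<m))
  ... | t , r | s , g = pair t s , h
    where
    h : ∀ k → k < suc m → R (nth (pair t s) k) k
    h zero    _         = subst (λ x → R x 0) (sym (π₁-pair t s)) r
    h (suc k) (s<s k<m) = subst (λ x → R (nth x k) (suc k)) (sym (π₂-pair t s)) (g k k<m)

  -- By collection, the witnesses t for all i < B are the entries of one coded sequence.
  bounded : ∀ {n k} {R : Rel (2 + n)} (B : Fn n) → Arith false (suc k) R →
            Arith true (2 + k) (λ v → ∀ i → i < ⟦ B ⟧ v → ∃[ t ] R (t ∷ i ∷ v))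
  bounded B r =
    quant (quantify false (atom (≤-arith (sucF (var (# 0))) (B ↑ ↑)) ⇒
                           substitute (nthF (var (# 1)) (var (# 0)) ∷ₛ var (# 0) ∷ₛ wk (wk idₛ)) r))
          (λ v → mk⇔ (collect (⟦ B ⟧ v)) (λ (s , f) i i<b → nth s i , f i i<b))

-- The complexity of R⁺ure

W-arith : ∀ {n} (e y : Fn n) → Arith true 1 (λ v → W (⟦ e ⟧ v) (⟦ y ⟧ v))
W-arith e y = quant (matrix (acceptsF (e ↑) (y ↑) (var (# 0))) (λ _ → ⇔-id _))
                    (λ v → W⇔accepts (⟦ e ⟧ v) (⟦ y ⟧ v))

toLen : ℕ → Len
toLen zero    = inf
toLen (suc n) = fin n

InDom-arith : ∀ {n b} (l i : Fn n) → Arith b 0 (λ v → InDom (toLen (⟦ l ⟧ v)) (⟦ i ⟧ v))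
-- For `l = suc n` the difference is `suc i ∸ n`, which vanishes iff `i < n`.
InDom-arith l i = matrix (if0F l zeroF (sucF (sucF i) ∸F l)) (λ v → eq (⟦ l ⟧ v) (⟦ i ⟧ v))
  where
  eq : ∀ l i → InDom (toLen l) i ⇔ (if0 l then 0 else (2 + i ∸ l)) ≡ 0
  eq zero    i = mk⇔ (λ _ → refl) (λ _ → tt)
  eq (suc n) i = mk⇔ m≤n⇒m∸n≡0 m∸n≡0⇒m≤n

-- Teaching sets as coded sequences

AllPairs-applyUpTo⁻ : ∀ {A : Set} {R : A → A → Set} (f : ℕ → A) m → AllPairs R (applyUpTo f m) →
                      ∀ a b → a < b → b < m → R (f a) (f b)
AllPairs-applyUpTo⁻ f (suc m) (r ∷ _)  zero    (suc b) _         (s<s b<m) =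
  All.applyUpTo⁻ (f ∘ suc) m r b<m
AllPairs-applyUpTo⁻ f (suc m) (_ ∷ rs) (suc a) (suc b) (s<s a<b) (s<s b<m) =
  AllPairs-applyUpTo⁻ (f ∘ suc) m rs a b a<b b<m

encodeList : List ℕ → ℕ
encodeList []      = 0
encodeList (x ∷ S) = pair x (encodeList S)

applyUpTo-encodeList : ∀ S → applyUpTo (nth (encodeList S)) (length S) ≡ S
applyUpTo-encodeList []      = refl
applyUpTo-encodeList (x ∷ S) = cong₂ _∷_ (π₁-pair x (encodeList S))
  (trans (cong (λ s → applyUpTo (nth s) (length S)) (π₂-pair x (encodeList S))) (applyUpTo-encodeList S))

-- The teaching set S_L of L = Sec w i j is { nth s k : k < m }.
Teaches : (l w i j m s : ℕ) → Set
Teaches l w i j m s =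
    (∀ a b → a < b → b < m → nth s a ≢ nth s b)
  × (∀ k → k < m → Sec w i j (nth s k))
  × (∀ i′ → InDom (toLen l) i′ → i ≤ i′ → ∀ j′ →
       (∀ k → k < m → Sec w i′ j′ (nth s k)) → Sec w i j ≐ Sec w i′ j′)

-- The bound `m ≤ D` is written `m < suc D` to fit `bounded-dual`.
Witness : (e D w l : ℕ) → Set
Witness e D w l =
    IsPartition e (toLen l) w
  × (∀ i → InDom (toLen l) i → ∃[ m ] (m < suc D × (∀ j → ∃[ s ] Teaches l w i j m s)))

teaches⁺ : ∀ l w i j m →
  (Σ (List ℕ) λ S → Unique S × length S ≡ m × All (Sec w i j) S
     × (∀ i′ → InDom (toLen l) i′ → i ≤ i′ → ∀ j′ → All (Sec w i′ j′) S → Sec w i j ≐ Sec w i′ j′)) →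
  ∃[ s ] Teaches l w i j m s
teaches⁺ l w i j _ (S , unique , refl , all , covers) = s ,
  AllPairs-applyUpTo⁻ (nth s) m (subst Unique (sym eq) unique) ,
  (λ k → All.applyUpTo⁻ (nth s) m (subst (All _) (sym eq) all)) ,
  (λ i′ dom i≤i′ j′ sub → covers i′ dom i≤i′ j′
     (subst (All _) eq (All.applyUpTo⁺₁ (nth s) m (sub _))))
  where
  s  = encodeList S
  m  = length S
  eq = applyUpTo-encodeList S

teaches⁻ : ∀ l w i j m s → Teaches l w i j m s →
  Σ (List ℕ) λ S → Unique S × length S ≡ m × All (Sec w i j) S
     × (∀ i′ → InDom (toLen l) i′ → i ≤ i′ → ∀ j′ → All (Sec w i′ j′) S → Sec w i j ≐ Sec w i′ j′)
teaches⁻ l w i j m s (unique , all , covers) =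
  applyUpTo (nth s) m ,
  AllPairs.applyUpTo⁺₁ (nth s) m (unique _ _) ,
  length-applyUpTo (nth s) m ,
  All.applyUpTo⁺₁ (nth s) m (all _) ,
  (λ i′ dom i≤i′ j′ sub → covers i′ dom i≤i′ j′ (λ k → All.applyUpTo⁻ (nth s) m sub))

Arith⇒Σ⁰₅ : ∀ {P : ℕ → Set} → Arith {1} true 5 (λ v → P (head v)) → IsΣ⁰₅ P
Arith⇒Σ⁰₅ (quant (quant (quant (quant (quant (matrix F p₀) p₁) p₂) p₃) p₄) p₅) =
  Fn.code G , λ e →
    Quant-cong true  (λ a → Quant-cong false (λ b → Quant-cong true (λ c → Quant-cong false (λ d →
    Quant-cong true  (λ f → code-zero (e ∷ a ∷ b ∷ c ∷ d ∷ f ∷ [])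
      ⇔-∘ p₀ (f ∷ d ∷ c ∷ b ∷ a ∷ e ∷ []))
      ⇔-∘ p₁ (d ∷ c ∷ b ∷ a ∷ e ∷ []))
      ⇔-∘ p₂ (c ∷ b ∷ a ∷ e ∷ []))
      ⇔-∘ p₃ (b ∷ a ∷ e ∷ []))
      ⇔-∘ p₄ (a ∷ e ∷ []))
      ⇔-∘ p₅ (e ∷ [])
  where
  -- Quantifiers extend the environment at the front, so the matrix sees the variables in reverse
  -- order.
  G = F [ var (# 5) ∷ₛ var (# 4) ∷ₛ var (# 3) ∷ₛ var (# 2) ∷ₛ var (# 1) ∷ₛ var (# 0) ∷ₛ []ₛ ]
  code-zero : ∀ v → ⟦ G ⟧ v ≡ 0 ⇔ eval (Fn.code G) v ≡ 0
  code-zero v = mk⇔ (trans (Fn.sound G v)) (trans (sym (Fn.sound G v)))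

-- Levels of the conditions defining `R⁺ure`

module _ (em : ExcludedMiddle 0ℓ) where
  open Classical em

  -- An implication between Σ⁰₁ conditions is Π⁰₂: the premise is raised to Σ⁰₂, the conclusion
  -- viewed as Π⁰₂.
  ≐-arith : ∀ {n} {A B : Rel (suc n)} → Arith true 1 A → Arith true 1 B →
            Arith false 2 (λ v → (λ x → A (x ∷ v)) ≐ (λ x → B (x ∷ v)))
  ≐-arith a b = quantify false ((raise a ⇒ dummy b) ∧ (raise b ⇒ dummy a))

  Sec≐L-arith : ∀ {n} (w i j e k : Fn n) →
    Arith false 2 (λ v → Sec (⟦ w ⟧ v) (⟦ i ⟧ v) (⟦ j ⟧ v) ≐ L (⟦ e ⟧ v) (⟦ k ⟧ v))
  Sec≐L-arith w i j e k = ≐-arith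
    (W-arith (w ↑) (pairF (i ↑) (pairF (j ↑) (var (# 0)))))
    (W-arith (e ↑) (pairF (k ↑) (var (# 0))))

  L≐Sec-arith : ∀ {n} (e k w i j : Fn n) →
    Arith false 2 (λ v → L (⟦ e ⟧ v) (⟦ k ⟧ v) ≐ Sec (⟦ w ⟧ v) (⟦ i ⟧ v) (⟦ j ⟧ v))
  L≐Sec-arith e k w i j = ≐-arith
    (W-arith (e ↑) (pairF (k ↑) (var (# 0))))
    (W-arith (w ↑) (pairF (i ↑) (pairF (j ↑) (var (# 0)))))

  Sec≐Sec-arith : ∀ {n} (w i j i′ j′ : Fn n) →
    Arith false 2 (λ v → Sec (⟦ w ⟧ v) (⟦ i ⟧ v) (⟦ j ⟧ v) ≐ Sec (⟦ w ⟧ v) (⟦ i′ ⟧ v) (⟦ j′ ⟧ v))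
  Sec≐Sec-arith w i j i′ j′ = ≐-arith
    (W-arith (w ↑) (pairF (i ↑) (pairF (j ↑) (var (# 0)))))
    (W-arith (w ↑) (pairF (i′ ↑) (pairF (j′ ↑) (var (# 0)))))

  IsPartition-arith : ∀ {n} (e l w : Fn n) →
    Arith false 4 (λ v → IsPartition (⟦ e ⟧ v) (toLen (⟦ l ⟧ v)) (⟦ w ⟧ v))
  IsPartition-arith e l w =
      -- The existential over a Π⁰₂ equality gives Σ⁰₃; the universal quantifiers in front then give
      -- Π⁰₄.
      quantify false (atom (InDom-arith (l ↑) (var (# 0))) ⇒
        quantify false (dummy (quantify true (dummy
          (Sec≐L-arith (w ↑ ↑ ↑) (var (# 2)) (var (# 1)) (e ↑ ↑ ↑) (var (# 0)))))))
    ∧ quantify false (dummy (quantify true (atom (InDom-arith (l ↑ ↑) (var (# 0))) ∧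
        quantify true (dummy
          (L≐Sec-arith (e ↑ ↑ ↑) (var (# 2)) (w ↑ ↑ ↑) (var (# 1)) (var (# 0)))))))
    ∧ quantify false (quantify false (
        atom (InDom-arith (l ↑ ↑) (var (# 1))) ⇒ atom (InDom-arith (l ↑ ↑) (var (# 0))) ⇒
        quantify false (quantify false (
          -- A premise must be Σ: `dummy` takes the equality to Σ⁰₃, and `raise` to the level of the
          -- other clauses.
          raise (dummy (Sec≐Sec-arith (w ↑ ↑ ↑ ↑) (var (# 3)) (var (# 1)) (var (# 2)) (var (# 0)))) ⇒
          atom (≡-arith (var (# 3)) (var (# 2)))))))

  -- The acceptance times of all elements are collected in one sequence. Σ⁰₂ is what a premise of a
  -- Π⁰₂ implication may be.
  AllSec-arith : ∀ {n} (w i j m s : Fn n) →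
    Arith true 2 (λ v → ∀ k → k < ⟦ m ⟧ v → Sec (⟦ w ⟧ v) (⟦ i ⟧ v) (⟦ j ⟧ v) (nth (⟦ s ⟧ v) k))
  AllSec-arith w i j m s = resp
    (λ v → mk⇔ (λ f k k<m → to (W⇔accepts _ _) (f k k<m)) (λ f k k<m → from (W⇔accepts _ _) (f k k<m)))
    (bounded m (atom (≡-arith
      (acceptsF (w ↑ ↑) (pairF (i ↑ ↑) (pairF (j ↑ ↑) (nthF (s ↑ ↑) (var (# 1))))) (var (# 0))) zeroF)))

  Teaches-arith : ∀ {n} (l w i j m s : Fn n) →
    Arith true 3 (λ v → Teaches (⟦ l ⟧ v) (⟦ w ⟧ v) (⟦ i ⟧ v) (⟦ j ⟧ v) (⟦ m ⟧ v) (⟦ s ⟧ v))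
  Teaches-arith l w i j m s =
      dummy (quantify false (quantify false (
        atom (≤-arith (sucF (var (# 1))) (var (# 0))) ⇒ atom (≤-arith (sucF (var (# 0))) (m ↑ ↑)) ⇒
        atom (~ ≡-arith {b = true} (nthF (s ↑ ↑) (var (# 1))) (nthF (s ↑ ↑) (var (# 0)))))))
    ∧ raise (AllSec-arith w i j m s)
    -- A Σ⁰₂ premise and a Π⁰₂ conclusion make this condition Π⁰₂, hence Σ⁰₃.
    ∧ dummy (quantify false (
        atom (InDom-arith (l ↑) (var (# 0))) ⇒ atom (≤-arith (i ↑) (var (# 0))) ⇒
        quantify false (
          AllSec-arith (w ↑ ↑) (var (# 1)) (var (# 0)) (m ↑ ↑) (s ↑ ↑) ⇒
          Sec≐Sec-arith (w ↑ ↑) (i ↑ ↑) (j ↑ ↑) (var (# 1)) (var (# 0)))))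

  -- If every `m` below the bound fails, each has a counterexample `j`, and `bounded` collects
  -- these. Negating that leaves a leading universal quantifier.
  bounded-dual : ∀ {n k} {R : Rel (2 + n)} (B : Fn n) → Arith true (suc k) R →
    Arith false (2 + k) (λ v → ∃[ m ] (m < ⟦ B ⟧ v × (∀ j → R (j ∷ m ∷ v))))
  bounded-dual {R = R} B r =
    resp (λ v → dual (⟦ B ⟧ v) (λ j m → R (j ∷ m ∷ v))) (~ bounded {R = λ v → ¬ R v} B (~ r))
    where
    dual : ∀ b (A : ℕ → ℕ → Set) →
           (∃[ m ] (m < b × (∀ j → A j m))) ⇔ (¬ (∀ m → m < b → ∃[ j ] ¬ A j m))
    dual b A = mk⇔
      (λ (m , m<b , f) g → let j , ¬a = g m m<b in ¬a (f j))
      (λ f → stable (λ g → f (λ m m<b →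
        stable (λ h → g (m , m<b , λ j → stable (λ ¬a → h (j , ¬a)))))))

  Witness-arith : Arith {4} false 4 (λ { (D ∷ w ∷ l ∷ e ∷ []) → Witness e D w l })
  Witness-arith = resp (λ { (D ∷ w ∷ l ∷ e ∷ []) → ⇔-id _ }) (
      IsPartition-arith (var (# 3)) (var (# 2)) (var (# 1))
    ∧ quantify false (atom (InDom-arith (var (# 3)) (var (# 0))) ⇒
        -- The existential over `s` is absorbed into Σ⁰₃, and the bounded choice of `m` with the
        -- quantifier over `j` yields Π⁰₄.
        bounded-dual (sucF (var (# 1)))
          (quantify true (Teaches-arith (var (# 6)) (var (# 5)) (var (# 3)) (var (# 1)) (var (# 2)) (var (# 0))))))

  R⁺ure⇔Witness : ∀ e → R⁺ure e ⇔ (∃[ l ] ∃[ w ] ∃[ D ] Witness e D w l)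
  R⁺ure⇔Witness e = mk⇔ witness sequence
    where
    witness : R⁺ure e → ∃[ l ] ∃[ w ] ∃[ D ] Witness e D w l
    witness (fin n , w , d , (partition , teaching) , D , d≤D) = suc n , w , D , partition ,
      λ i dom → d i , s≤s (d≤D i dom) , λ j → teaches⁺ (suc n) w i j (d i) (teaching i dom j)
    witness (inf , w , d , (partition , teaching) , D , d≤D) = 0 , w , D , partition ,
      λ i dom → d i , s≤s (d≤D i dom) , λ j → teaches⁺ 0 w i j (d i) (teaching i dom j)
    sequence : ∃[ l ] ∃[ w ] ∃[ D ] Witness e D w l → R⁺ure e
    sequence (l , w , D , partition , f) = toLen l , w , d , (partition , teaching) , D , d≤D
      where
      order : ∀ i → Dec (InDom (toLen l) i) → ℕ
      order i (yes dom) = proj₁ (f i dom)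
      -- Outside the domain any value would do.
      order i (no _)    = 0
      d : ℕ → ℕ
      d i = order i em
      teaching : IsTeaching (toLen l) w d
      -- `d i` comes from the proof that `em` returns, so the teaching sets must be taken from
      -- `dom′`, not from `dom`.
      teaching i dom j with em {InDom (toLen l) i}
      ... | no ¬dom  = contradiction dom ¬dom
      ... | yes dom′ = let m , _ , g = f i dom′ in teaches⁻ l w i j m (proj₁ (g j)) (proj₂ (g j))
      d≤D : ∀ i → InDom (toLen l) i → d i ≤ D
      d≤D i dom with em {InDom (toLen l) i}
      ... | no ¬dom  = contradiction dom ¬dom
      ... | yes dom′ = s≤s⁻¹ (proj₁ (proj₂ (f i dom′)))

theorem14 : ExcludedMiddle 0ℓ → IsΣ⁰₅ R⁺ure
theorem14 em = Arith⇒Σ⁰₅ (resp (λ { (e ∷ []) → R⁺ure⇔Witness em e })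
  -- `dummy` takes Π⁰₄ to Σ⁰₅, and the three existential quantifiers are absorbed.
  (quantify true (quantify true (quantify true (dummy (Witness-arith em))))))
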